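{- Assume CH. Then there exists a MAD family $\mathcal{A}\subseteq[\omega]^\omega$ such that (i) $\mathcal{A}$ is a $\lambda$-set, i.e. every countable subset of $\mathcal{A}$ is a relative $G_\delta$ subset of $\mathcal{A}$, and (ii) $\mathcal{A}$ is concentrated on the finite subsets of $\omega$, i.e. every open set $U\subseteq P(\omega)\cong 2^\omega$ containing $[\omega]^{<\omega}$ contains all but countably many elements of $\mathcal{A}$.
   Context: $[\omega]^\omega$ and $[\omega]^{<\omega}$ denote the sets of infinite and finite subsets of $\omega$; $P(\omega)$ is identified with $2^\omega$ via characteristic functions, with the product topology. A MAD family is an infinite set $\mathcal{A}\subseteq[\omega]^\omega$ such that any two distinct elements have finite intersection and every infinite subset of $\omega$ has infinite intersection with some element of $\mathcal{A}$. CH is the continuum hypothesis $2^{\aleph_0}=\aleph_1$. -}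

module Defs where

open import Level using (0ℓ; suc)
open import Data.Bool using (Bool; true; _∧_)
open import Data.Fin using (Fin)
open import Data.List using (List)
open import Data.List.Relation.Unary.All using (All)
open import Data.Nat using (ℕ)
open import Data.Product using (Σ; Σ-syntax; ∃-syntax; _×_; proj₁)
open import Function.Bundles using (Injection; Inverse; _⇔_)
open import Induction.WellFounded using (WellFounded)
open import Relation.Binary using (Rel; Setoid; IsStrictTotalOrder; _Respects_)
open import Relation.Binary.PropositionalEquality using (_≡_; _≗_; _→-setoid_; setoid)
import Relation.Binary.Construct.On as On
open import Relation.Nullary using (¬_)
open import Relation.Unary using (Pred; ∁; _∩_)

-- Cardinality is taken on setoids, because a subset given by a
-- proof-relevant predicate has to be counted up to equality of its elements.

Subset : (S : Setoid 0ℓ 0ℓ) → Pred (Setoid.Carrier S) 0ℓ → Setoid 0ℓ 0ℓ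
Subset S P = On.setoid {B = Σ (Setoid.Carrier S) P} S proj₁

Finite : Setoid 0ℓ 0ℓ → Set
Finite S = ∃[ n ] Injection S (setoid (Fin n))

Infinite : Setoid 0ℓ 0ℓ → Set
Infinite S = ¬ Finite S

Countable : Setoid 0ℓ 0ℓ → Set
Countable S = Injection S (setoid ℕ)

-- P(ω) ≅ 2^ω; two subsets of ω are equal when they agree pointwise.

𝒫ω : Set
𝒫ω = ℕ → Bool

𝒫ω-setoid : Setoid 0ℓ 0ℓ
𝒫ω-setoid = ℕ →-setoid Bool

⟦_⟧ : 𝒫ω → Setoid 0ℓ 0ℓ
⟦ X ⟧ = Subset (setoid ℕ) (λ n → X n ≡ true)

infixr 7 _⊓_

_⊓_ : 𝒫ω → 𝒫ω → 𝒫ω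
(X ⊓ Y) n = X n ∧ Y n

record Family : Set (suc 0ℓ) where
  field
    mem  : Pred 𝒫ω 0ℓ
    resp : mem Respects _≗_

open Family public

infix 4 _⊑_

_⊑_ : Family → Family → Set
𝒞 ⊑ 𝒜 = ∀ X → mem 𝒞 X → mem 𝒜 X

-- Product topology: the basic neighbourhoods of X are given by fixing
-- finitely many coordinates.  An open U automatically respects _≗_.

Open : Pred 𝒫ω 0ℓ → Set
Open U = ∀ X → U X → Σ[ F ∈ List ℕ ] (∀ Y → All (λ n → X n ≡ Y n) F → U Y)

record IsMAD (𝒜 : Family) : Set where
  field
    infinite       : Infinite (Subset 𝒫ω-setoid (mem 𝒜))
    members        : ∀ X → mem 𝒜 X → Infinite ⟦ X ⟧
    almostDisjoint : ∀ X Y → mem 𝒜 X → mem 𝒜 Y → ¬ (X ≗ Y) → Finite ⟦ X ⊓ Y ⟧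
    maximal        : ∀ X → Infinite ⟦ X ⟧ → ∃[ Y ] (mem 𝒜 Y × Infinite ⟦ X ⊓ Y ⟧)

-- For 𝒞 ⊑ 𝒜: 𝒞 = 𝒜 ∩ ⋂ₙ Uₙ with every Uₙ open in P(ω).

RelativeGδ : Family → Family → Set (suc 0ℓ)
RelativeGδ 𝒜 𝒞 =
  Σ[ U ∈ (ℕ → Pred 𝒫ω 0ℓ) ]
    ((∀ n → Open (U n)) × (∀ X → mem 𝒜 X → mem 𝒞 X ⇔ (∀ n → U n X)))

IsLambdaSet : Family → Set (suc 0ℓ)
IsLambdaSet 𝒜 =
  ∀ (𝒞 : Family) → 𝒞 ⊑ 𝒜 → Countable (Subset 𝒫ω-setoid (mem 𝒞)) → RelativeGδ 𝒜 𝒞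

ConcentratedOnFinite : Family → Set (suc 0ℓ)
ConcentratedOnFinite 𝒜 =
  ∀ (U : Pred 𝒫ω 0ℓ) → Open U → (∀ X → Finite ⟦ X ⟧ → U X) →
  Countable (Subset 𝒫ω-setoid (mem 𝒜 ∩ ∁ U))

-- (W , _<_) has order type ω₁, the least uncountable ordinal.

record IsOmega₁ {W : Set} (_<_ : Rel W 0ℓ) : Set where
  field
    isStrictTotalOrder : IsStrictTotalOrder _≡_ _<_
    wellFounded        : WellFounded _<_
    uncountable        : ¬ Countable (setoid W)
    initialCountable   : ∀ w → Countable (Subset (setoid W) (_< w))

-- 2^ℵ₀ = ℵ₁.

CH : Set (suc 0ℓ)
CH = Σ[ W ∈ Set ] Σ[ _<_ ∈ Rel W 0ℓ ] (IsOmega₁ _<_ × Inverse 𝒫ω-setoid (setoid W))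

{-# OPTIONS --safe #-}

-- CH enumerates both the functions f γ : ω → ω and the subsets Y γ of ω along
-- ω₁; let g γ eventually dominate f β for all β ≤ γ.  Put X γ ⊆ Y γ with all
-- gaps longer than g γ prescribes, and keep X γ whenever Y γ is infinite and
-- almost disjoint from the sets kept before: this is a maximal almost disjoint
-- family, and for every function h all but countably many of its members
-- eventually have gaps longer than h prescribes.
--
-- An open set around the finite sets contains, for some h, every X that misses
-- an interval [n , h n); this gives concentration.  Given countably many members,
-- choose h such that each of them has infinitely many gaps shorter than h
-- prescribes.  That is a Gδ condition, and only countably many further members
-- satisfy it, each of which is removed by one open set; this gives the λ-property.
--
-- The family is infinite because only those Y γ are used which have infinite
-- intersection with at most one piece of a fixed partition of ω into infinitely
-- many infinite pieces.

module Submission where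

open import Defs
open import Level using (0ℓ)
open import Axiom.ExcludedMiddle using (ExcludedMiddle)
open import Data.Bool using (Bool; true; false; _∧_; if_then_else_)
open import Data.Bool.Properties using (∧-conicalˡ; ∧-conicalʳ; ¬-not; ∧-identityʳ; ∧-zeroʳ)
open import Data.Fin using (fromℕ<)
open import Data.Fin.Properties using (fromℕ<-cong; fromℕ<-injective; ℕ→Fin-notInjective)
open import Data.List using ([]; _∷_; _++_)
import Data.List.Extrema
open import Data.List.Relation.Unary.All as All using ([]; _∷_)
open import Data.List.Relation.Unary.All.Properties using (++⁻ˡ; ++⁻ʳ)
open import Data.Nat using (ℕ; zero; suc; _+_; _≤_; _<_; _∸_; _⊔_; _≟_; _≤?_; _<?_; z≤n; s≤s)
open import Data.Nat.Properties using (≤-refl; ≤-trans; <-trans; <-≤-trans; <-cmp; <⇒≢; <⇒≱; ≤⇒≯; ≰⇒>; ≮⇒≥; ≤∧≢⇒<; m≤n⇒m<n∨m≡n; m≤m⊔n; m≤n⊔m; m≤n+m; m∸n+n≡m; +-suc; +-identityʳ; suc-injective; ≤-totalOrder)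
open import Data.Product using (Σ; Σ-syntax; ∃-syntax; _×_; _,_; proj₁; proj₂)
open import Data.Sum using (_⊎_; inj₁; inj₂)
open import Function.Base using (_∘_; id)
open import Function.Bundles using (Injection; Inverse; mk⇔)
open import Function.Definitions using (Injective)
open import Induction.WellFounded using (Acc; acc)
open import Relation.Binary using (Rel; Setoid; IsStrictTotalOrder; tri<; tri≈; tri>)
open import Relation.Binary.PropositionalEquality using (_≡_; _≢_; _≗_; refl; sym; trans; cong; cong₂; subst; setoid)
open import Relation.Nullary using (¬_; Dec; yes; no; does; contradiction)
open import Relation.Nullary.Decidable using (dec-true; dec-false; decidable-stable)
open import Relation.Unary using (Pred)

private
  module ℕ-Extrema = Data.List.Extrema ≤-totalOrder

does-true : ∀ {A : Set} (a? : Dec A) → does a? ≡ true → A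
does-true (yes a) _ = a

-- Finite and infinite subsets of ω as bounded and unbounded ones

infix 4 _∈_ _⊆_

_∈_ : ℕ → 𝒫ω → Set
n ∈ X = X n ≡ true

_⊆_ : 𝒫ω → 𝒫ω → Set
X ⊆ Y = ∀ {n} → n ∈ X → n ∈ Y

≗⇒⊆ : ∀ {X Y} → X ≗ Y → X ⊆ Y
≗⇒⊆ X≗Y {n} = trans (sym (X≗Y n))

⊓-⊆ˡ : ∀ X Y → X ⊓ Y ⊆ X
⊓-⊆ˡ X Y {n} = ∧-conicalˡ (X n) (Y n)

⊓-⊆ʳ : ∀ X Y → X ⊓ Y ⊆ Y
⊓-⊆ʳ X Y {n} = ∧-conicalʳ (X n) (Y n)

⊓-greatest : ∀ {X Y Z} → Z ⊆ X → Z ⊆ Y → Z ⊆ X ⊓ Y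
⊓-greatest Z⊆X Z⊆Y n∈Z = cong₂ _∧_ (Z⊆X n∈Z) (Z⊆Y n∈Z)

⊓-mono : ∀ {X X′ Y Y′} → X ⊆ X′ → Y ⊆ Y′ → X ⊓ Y ⊆ X′ ⊓ Y′
⊓-mono {X} {X′} {Y} {Y′} X⊆X′ Y⊆Y′ =
  ⊓-greatest {X′} {Y′} {X ⊓ Y} (λ {n} → X⊆X′ ∘ ⊓-⊆ˡ X Y {n}) (λ {n} → Y⊆Y′ ∘ ⊓-⊆ʳ X Y {n})

Unbounded : 𝒫ω → Set
Unbounded X = ∀ m → ∃[ n ] (m ≤ n × n ∈ X)

Bounded : 𝒫ω → Set
Bounded X = ∃[ m ] (∀ {n} → n ∈ X → n < m)

Unbounded-mono : ∀ {X Y} → X ⊆ Y → Unbounded X → Unbounded Y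
Unbounded-mono X⊆Y unb m with n , m≤n , n∈X ← unb m = n , m≤n , X⊆Y n∈X

Bounded-anti : ∀ {X Y} → X ⊆ Y → Bounded Y → Bounded X
Bounded-anti X⊆Y (m , b) = m , b ∘ X⊆Y

Bounded⇒¬Unbounded : ∀ {X} → Bounded X → ¬ Unbounded X
Bounded⇒¬Unbounded (m , b) unb with n , m≤n , n∈X ← unb m = ≤⇒≯ m≤n (b n∈X)

Bounded⇒Finite : ∀ {X} → Bounded X → Finite ⟦ X ⟧
Bounded⇒Finite (m , b) = m , record
  { to        = λ (n , n∈X) → fromℕ< (b n∈X)
  ; cong      = λ {x} {y} eq → fromℕ<-cong (proj₁ x) (proj₁ y) eq (b (proj₂ x)) (b (proj₂ y))
  ; injective = λ {x} {y} → fromℕ<-injective (proj₁ x) (proj₁ y) (b (proj₂ x)) (b (proj₂ y))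
  }

increasing⇒< : (s : ℕ → ℕ) → (∀ i → s i < s (suc i)) → ∀ {i j} → i < j → s i < s j
increasing⇒< s inc {i} {suc j} (s≤s i≤j) with m≤n⇒m<n∨m≡n i≤j
... | inj₁ i<j  = <-trans (increasing⇒< s inc i<j) (inc j)
... | inj₂ refl = inc j

increasing⇒injective : (s : ℕ → ℕ) → (∀ i → s i < s (suc i)) → Injective _≡_ _≡_ s
increasing⇒injective s inc {i} {j} eq with <-cmp i j
... | tri< i<j _ _ = contradiction eq (<⇒≢ (increasing⇒< s inc i<j))
... | tri≈ _ i≡j _ = i≡j
... | tri> _ _ j<i = contradiction (sym eq) (<⇒≢ (increasing⇒< s inc j<i))

Unbounded⇒Infinite : ∀ {X} → Unbounded X → Infinite ⟦ X ⟧
Unbounded⇒Infinite {X} unb (n , inj) =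
  ℕ→Fin-notInjective (to ∘ s) (increasing⇒injective (proj₁ ∘ s) s-inc ∘ injective)
  where
  open Injection inj using (to; injective)
  s : ℕ → Σ ℕ (_∈ X)
  s zero    = let n , _ , n∈X = unb 0 in n , n∈X
  s (suc i) = let n , _ , n∈X = unb (suc (proj₁ (s i))) in n , n∈X
  s-inc : ∀ i → proj₁ (s i) < proj₁ (s (suc i))
  s-inc i = proj₁ (proj₂ (unb (suc (proj₁ (s i)))))

-- The thinning of a set

module Thin (g : ℕ → ℕ) (Y : 𝒫ω) where

  -- Greedy choice: `threshold n` is the maximum of 0 and the values of `g` at the points chosen
  -- below `n`.
  threshold : ℕ → ℕ
  thin : 𝒫ω

  threshold zero    = 0
  threshold (suc n) = if thin n then threshold n ⊔ g n else threshold n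

  thin n = Y n ∧ does (threshold n ≤? n)

  thin-⊆ : thin ⊆ Y
  thin-⊆ {n} = ∧-conicalˡ (Y n) _

  threshold-≤ : ∀ {n} → n ∈ thin → threshold n ≤ n
  threshold-≤ {n} n∈ = does-true (threshold n ≤? n) (∧-conicalʳ (Y n) _ n∈)

  threshold-suc : ∀ n → threshold n ≤ threshold (suc n)
  threshold-suc n with thin n
  ... | true  = m≤m⊔n (threshold n) (g n)
  ... | false = ≤-refl

  threshold-jump : ∀ {n} → n ∈ thin → g n ≤ threshold (suc n)
  threshold-jump {n} n∈ rewrite n∈ = m≤n⊔m (threshold n) (g n)

  threshold-mono : ∀ {m n} → m ≤ n → threshold m ≤ threshold n
  threshold-mono {m} {n} m≤n with m≤n⇒m<n∨m≡n m≤n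
  threshold-mono {m} {suc n} _ | inj₁ (s≤s m≤n) = ≤-trans (threshold-mono m≤n) (threshold-suc n)
  ... | inj₂ refl = ≤-refl

  thin-gaps : ∀ {m n} → m ∈ thin → n ∈ thin → m < n → g m ≤ n
  thin-gaps m∈ n∈ m<n =
    ≤-trans (threshold-jump m∈) (≤-trans (threshold-mono m<n) (threshold-≤ n∈))

  next-or-constant : ∀ m d → (∃[ n ] (m ≤ n × n ∈ thin)) ⊎ threshold (d + m) ≡ threshold m
  next-or-constant m zero = inj₂ refl
  next-or-constant m (suc d) with next-or-constant m d | thin (d + m) in eq
  ... | inj₁ found | _     = inj₁ found
  ... | inj₂ const | true  = inj₁ (d + m , m≤n+m m d , eq)
  ... | inj₂ const | false = inj₂ const

  thin-unbounded : Unbounded Y → Unbounded thin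
  -- If nothing is chosen from `m` up to this point `y`, the threshold at `y` is still
  -- `threshold m ≤ y`, so `y` itself is chosen.
  thin-unbounded unb m with unb (m ⊔ threshold m)
  ... | y , m⊔t≤y , y∈Y with y ∸ m | m∸n+n≡m (≤-trans (m≤m⊔n m (threshold m)) m⊔t≤y)
  ... | d | refl with next-or-constant m d
  ... | inj₁ found = found
  ... | inj₂ const = d + m , m≤n+m m d ,
    cong₂ _∧_ y∈Y (dec-true (_ ≤? _) (subst (_≤ d + m) (sym const) (≤-trans (m≤n⊔m m (threshold m)) m⊔t≤y)))

open Thin using (thin; thin-⊆; thin-gaps; thin-unbounded)

-- Cantor's enumeration of ω × ω

next : ℕ × ℕ → ℕ × ℕ
next (zero  , b) = suc b , 0
next (suc a , b) = a , suc b

unpair : ℕ → ℕ × ℕ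
unpair zero    = 0 , 0
unpair (suc n) = next (unpair n)

unpair-surjective : ∀ a b → ∃[ n ] unpair n ≡ (a , b)
unpair-surjective a b = onDiagonal (a + b) b a refl
  where
  onDiagonal : ∀ s b a → a + b ≡ s → ∃[ n ] unpair n ≡ (a , b)
  onDiagonal s       (suc b) a       eq
    with n , eq′ ← onDiagonal s b (suc a) (trans (sym (+-suc a b)) eq) = suc n , cong next eq′
  onDiagonal s       zero    zero    eq = 0 , refl
  onDiagonal (suc s) zero    (suc a) eq
    with n , eq′ ← onDiagonal s a 0 (suc-injective (trans (sym (+-identityʳ (suc a))) eq)) = suc n , cong next eq′

unpair₂-≤ : ∀ n → proj₂ (unpair n) ≤ n
unpair₂-≤ zero = z≤n
unpair₂-≤ (suc n) with unpair n | unpair₂-≤ n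
... | zero  , b | _   = z≤n
... | suc a , b | b≤n = s≤s b≤n

-- A partition of ω into infinitely many infinite columns

column : ℕ → 𝒫ω
column k n = does (proj₁ (unpair n) ≟ k)

column-unique : ∀ {k l n} → n ∈ column k → n ∈ column l → k ≡ l
column-unique {k} {l} {n} n∈k n∈l =
  trans (sym (does-true (proj₁ (unpair n) ≟ k) n∈k)) (does-true (proj₁ (unpair n) ≟ l) n∈l)

column-unbounded : ∀ k → Unbounded (column k)
column-unbounded k m with n , eq ← unpair-surjective k m =
  n , subst (_≤ n) (cong proj₂ eq) (unpair₂-≤ n) , dec-true (_ ≟ k) (cong proj₁ eq)

-- The eligibility condition that keeps the family infinite: such a set cannot serve two columns in
-- the maximality property.
Small : 𝒫ω → Set
Small X = ∀ k l → Unbounded (X ⊓ column k) → Unbounded (X ⊓ column l) → k ≡ l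

Small-anti : ∀ {X Y} → X ⊆ Y → Small Y → Small X
Small-anti {X} {Y} X⊆Y small k l unbₖ unbₗ = small k l (mono k unbₖ) (mono l unbₗ)
  where
  mono : ∀ j → Unbounded (X ⊓ column j) → Unbounded (Y ⊓ column j)
  mono j = Unbounded-mono {X ⊓ column j} {Y ⊓ column j}
             (λ {n} → ⊓-mono {X} {Y} {column j} {column j} X⊆Y id {n})

-- Functions are coded as sets, so that the enumeration of `𝒫ω` also enumerates them.
graph : (ℕ → ℕ) → 𝒫ω
graph h i = does (proj₂ (unpair i) ≟ h (proj₁ (unpair i)))

maxUpTo : (ℕ → ℕ) → ℕ → ℕ
maxUpTo f zero    = f 0
maxUpTo f (suc n) = maxUpTo f n ⊔ f (suc n)

≤-maxUpTo : ∀ f {k n} → k ≤ n → f k ≤ maxUpTo f n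
≤-maxUpTo f {n = zero} z≤n = ≤-refl
≤-maxUpTo f {n = suc n} k≤1+n with m≤n⇒m<n∨m≡n k≤1+n
... | inj₁ (s≤s k≤n) = ≤-trans (≤-maxUpTo f k≤n) (m≤m⊔n _ _)
... | inj₂ refl      = m≤n⊔m (maxUpTo f n) _

-- Open sets containing the finite sets

MissesInterval : 𝒫ω → ℕ → ℕ → Set
MissesInterval X n m = ∀ i → n ≤ i → i < m → X i ≡ false

module _ {U : Pred 𝒫ω 0ℓ} (U-open : Open U) (fin⊆U : ∀ X → Finite ⟦ X ⟧ → U X) where

  private
    update : 𝒫ω → ℕ → Bool → 𝒫ω
    update Z k b i = if does (i ≟ k) then b else Z i

  -- The prescription of X on [k , n) is released one point at a time, starting
  -- from a single finite set at k = 0.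
  interval-length-on : ∀ n k Z → ∃[ m ] (∀ X → (∀ i → k ≤ i → i < n → X i ≡ Z i) →
                                         MissesInterval X n m → U X)
  interval-length-on n zero Z = suc (max 0 F) , λ X X≗Z miss →
    F⊆U X (All.map (λ {i} i≤max → agree X X≗Z miss i (s≤s i≤max)) (xs≤max 0 F))
    where
    open ℕ-Extrema using (max; xs≤max)
    Z↾n : 𝒫ω
    Z↾n i = Z i ∧ does (i <? n)
    nbhd = U-open Z↾n (fin⊆U Z↾n (Bounded⇒Finite {Z↾n}
             (n , λ {i} i∈ → does-true (i <? n) (∧-conicalʳ (Z i) _ i∈))))
    F   = proj₁ nbhd
    F⊆U = proj₂ nbhd
    agree : ∀ X → (∀ i → 0 ≤ i → i < n → X i ≡ Z i) → MissesInterval X n (suc (max 0 F)) →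
            ∀ i → i < suc (max 0 F) → Z↾n i ≡ X i
    agree X X≗Z miss i i<max with i <? n
    ... | yes i<n = trans (cong (Z i ∧_) (dec-true (i <? n) i<n)) (trans (∧-identityʳ (Z i)) (sym (X≗Z i z≤n i<n)))
    ... | no  i≮n = trans (cong (Z i ∧_) (dec-false (i <? n) i≮n)) (trans (∧-zeroʳ (Z i)) (sym (miss i (≮⇒≥ i≮n) i<max)))
  -- The value of `X` at `k` is now free, so the bound has to serve both possibilities.
  interval-length-on n (suc k) Z = bound false ⊔ bound true , λ X X≗Z miss →
    proj₂ (interval-length-on n k (update Z k (X k))) X (agree X X≗Z)
      (λ i n≤i i<m → miss i n≤i (<-≤-trans i<m (bound-≤ (X k))))
    where
    bound : Bool → ℕ
    bound b = proj₁ (interval-length-on n k (update Z k b))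
    bound-≤ : ∀ b → bound b ≤ bound false ⊔ bound true
    bound-≤ false = m≤m⊔n (bound false) (bound true)
    bound-≤ true  = m≤n⊔m (bound false) (bound true)
    agree : ∀ X → (∀ i → suc k ≤ i → i < n → X i ≡ Z i) →
            ∀ i → k ≤ i → i < n → X i ≡ update Z k (X k) i
    agree X X≗Z i k≤i i<n with i ≟ k
    ... | yes refl = cong (if_then X k else Z k) (sym (dec-true (k ≟ k) refl))
    ... | no  i≢k  = trans (X≗Z i (≤∧≢⇒< k≤i (i≢k ∘ sym)) i<n)
                       (cong (if_then X k else Z i) (sym (dec-false (i ≟ k) i≢k)))

  -- At `k = n` nothing is prescribed: a single `m` serves all of the finitely many traces on
  -- `[0 , n)`.
  interval-length : ∀ n → ∃[ m ] (∀ X → MissesInterval X n m → U X)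
  interval-length n with m , U-if ← interval-length-on n n (λ _ → false) =
    m , λ X → U-if X (λ i n≤i i<n → contradiction i<n (≤⇒≯ n≤i))

-- Decoding, diagonalisation and small subsets, by excluded middle

module Classical (em : ExcludedMiddle 0ℓ) where

  dne : ∀ {P : Set} → ¬ ¬ P → P
  dne = decidable-stable em

  ¬Bounded⇒Unbounded : ∀ {X} → ¬ Bounded X → Unbounded X
  ¬Bounded⇒Unbounded ¬b m =
    dne λ none → ¬b (m , λ {n} n∈X → ≰⇒> λ m≤n → none (n , m≤n , n∈X))

  Infinite⇒Unbounded : ∀ {X} → Infinite ⟦ X ⟧ → Unbounded X
  Infinite⇒Unbounded {X} inf = ¬Bounded⇒Unbounded {X} (inf ∘ Bounded⇒Finite {X})

  -- Only the values on graphs matter; for other sets the choice of `i` and the default 0 are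
  -- arbitrary.
  decode : 𝒫ω → ℕ → ℕ
  decode X n with em {∃[ i ] (i ∈ X × proj₁ (unpair i) ≡ n)}
  ... | yes (i , _) = proj₂ (unpair i)
  ... | no  _       = 0

  decode-graph : ∀ {X h} → X ≗ graph h → decode X ≗ h
  decode-graph {X} {h} X≗h n with em {∃[ i ] (i ∈ X × proj₁ (unpair i) ≡ n)}
  ... | yes (i , i∈X , refl) = does-true (_ ≟ h (proj₁ (unpair i))) (trans (sym (X≗h i)) i∈X)
  ... | no  none with i , eq ← unpair-surjective n (h n) =
    contradiction (i , trans (X≗h i) (dec-true (_ ≟ _) i∈graph) , cong proj₁ eq) none
    where
    i∈graph : proj₂ (unpair i) ≡ h (proj₁ (unpair i))
    i∈graph = trans (cong proj₂ eq) (cong h (sym (cong proj₁ eq)))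

  -- `g n` is the largest of the witnesses at `n` for the codes up to `n`, so the element with code
  -- `k` is served from `n = k` on. This yields both a function dominating countably many others and
  -- one exceeding the gaps of countably many sets.
  diagonal-bound : (S : Setoid 0ℓ 0ℓ) → Countable S → let open Setoid S using (Carrier; _≈_) in
    (R : Carrier → ℕ → ℕ → Set) →
    (∀ {x y n m} → x ≈ y → R x n m → R y n m) →
    (∀ {x n m m′} → m ≤ m′ → R x n m → R x n m′) →
    (∀ x n → ∃[ m ] R x n m) →
    ∃[ g ] (∀ x → ∃[ N ] (∀ n → N ≤ n → R x n (g n)))
  diagonal-bound S count R R-resp R-mono R-total = g , λ x → to x , λ n k≤n →
    R-mono (≤-maxUpTo (λ k → witness k n) k≤n) (witness-R x n)
    where
    open Injection count using (to; injective)
    witness : ℕ → ℕ → ℕ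
    witness k n with em {∃[ x ] to x ≡ k}
    ... | yes (x , _) = proj₁ (R-total x n)
    ... | no  _       = 0
    witness-R : ∀ x n → R x n (witness (to x) n)
    witness-R x n with em {∃[ y ] to y ≡ to x}
    ... | yes (y , eq) = R-resp (injective eq) (proj₂ (R-total y n))
    ... | no  none     = contradiction (x , refl) none
    g : ℕ → ℕ
    g n = maxUpTo (λ k → witness k n) n

  -- Either `X` meets every column in a bounded set, or its trace on one column meets no other
  -- column.
  small-subset : ∀ {X} → Unbounded X → ∃[ Y ] (Y ⊆ X × Unbounded Y × Small Y)
  small-subset {X} unb with em {∃[ k ] Unbounded (X ⊓ column k)}
  ... | no  none = X , id , unb , λ k _ unbₖ _ → contradiction (k , unbₖ) none
  ... | yes (k , unbₖ) = X ⊓ column k , (λ {n} → ⊓-⊆ˡ X (column k) {n}) , unbₖ ,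
    λ i j unbᵢ unbⱼ → trans (sym (only-k unbᵢ)) (only-k unbⱼ)
    where
    only-k : ∀ {l} → Unbounded ((X ⊓ column k) ⊓ column l) → k ≡ l
    only-k {l} unbₗ with n , _ , n∈ ← unbₗ 0 =
      column-unique {k} {l} {n} (⊓-⊆ʳ X (column k) {n} (⊓-⊆ˡ (X ⊓ column k) (column l) {n} n∈))
                                (⊓-⊆ʳ (X ⊓ column k) (column l) {n} n∈)

-- The recursion along ω₁

module Construction (em : ExcludedMiddle 0ℓ) {W : Set} {_≺_ : Rel W 0ℓ}
                    (isω₁ : IsOmega₁ _≺_) (enum : Inverse 𝒫ω-setoid (setoid W)) where

  open Classical em
  open IsOmega₁ isω₁
  open IsStrictTotalOrder isStrictTotalOrder using (compare)

  Y : W → 𝒫ω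
  Y = Inverse.from enum

  Y-index : ∀ Z → ∃[ γ ] Y γ ≗ Z
  Y-index Z = Inverse.to enum Z , Inverse.strictlyInverseʳ enum Z

  f : W → ℕ → ℕ
  f γ = decode (Y γ)

  f-index : ∀ h → ∃[ δ ] f δ ≗ h
  f-index h with δ , eq ← Y-index (graph h) = δ , decode-graph eq

  earlier-bound : ∀ γ → ∃[ g ] (∀ ((β , _) : Σ W (_≺ γ)) → ∃[ N ] (∀ n → N ≤ n → f β n ≤ g n))
  earlier-bound γ = diagonal-bound (Subset (setoid W) (_≺ γ)) (initialCountable γ)
    (λ (β , _) n m → f β n ≤ m)
    (λ {_} {_} {n} {m} eq → subst (λ β → f β n ≤ m) eq)
    (λ m≤m′ f≤m → ≤-trans f≤m m≤m′)
    (λ (β , _) n → f β n , ≤-refl)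

  g : W → ℕ → ℕ
  g γ n = f γ n ⊔ proj₁ (earlier-bound γ) n

  g-dominates : ∀ {γ δ} → ¬ (γ ≺ δ) → ∃[ N ] (∀ n → N ≤ n → f δ n ≤ g γ n)
  g-dominates {γ} {δ} γ⊀δ with compare γ δ
  ... | tri< γ≺δ _ _  = contradiction γ≺δ γ⊀δ
  ... | tri≈ _ refl _ = 0 , λ n _ → m≤m⊔n (f δ n) _
  ... | tri> _ _ δ≺γ with N , f≤ ← proj₂ (earlier-bound γ) (δ , δ≺γ) =
    N , λ n N≤n → ≤-trans (f≤ n N≤n) (m≤n⊔m (f γ n) _)

  X : W → 𝒫ω
  X γ = thin (g γ) (Y γ)

  X⊆Y : ∀ γ → X γ ⊆ Y γ
  X⊆Y γ = thin-⊆ (g γ) (Y γ)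

  Eligible : W → Set
  Eligible γ = Unbounded (Y γ) × Small (Y γ)

  -- "Kept γ iff Y γ is eligible and almost disjoint from all X β with β ≺ γ and
  -- Kept β" is not a positive definition; defining the negation along with it is.
  data Kept    (γ : W) : Set
  data Dropped (γ : W) : Set

  data Kept γ where
    kept : Eligible γ → (∀ {β} → β ≺ γ → Dropped β ⊎ Bounded (Y γ ⊓ X β)) → Kept γ

  data Dropped γ where
    ineligible : ¬ Eligible γ → Dropped γ
    meets      : ∀ {β} → β ≺ γ → Kept β → Unbounded (Y γ ⊓ X β) → Dropped γ

  -- Both derivations shrink with their roles exchanged: the second contains a `Kept β`, the first a
  -- `Dropped β` for the same `β`.
  kept-not-dropped : ∀ {γ} → Kept γ → ¬ Dropped γ
  kept-not-dropped (kept elig _) (ineligible ¬elig) = ¬elig elig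
  kept-not-dropped {γ} (kept _ ad) (meets {β} β≺γ keptβ unb) with ad β≺γ
  ... | inj₁ droppedβ = kept-not-dropped keptβ droppedβ
  ... | inj₂ bdd      = Bounded⇒¬Unbounded {Y γ ⊓ X β} bdd unb

  kept-or-dropped : ∀ γ → Kept γ ⊎ Dropped γ
  kept-or-dropped γ = go (wellFounded γ)
    where
    go : ∀ {γ} → Acc _≺_ γ → Kept γ ⊎ Dropped γ
    go {γ} (acc rs) with em {Eligible γ}
                       | em {∃[ β ] (β ≺ γ × Kept β × Unbounded (Y γ ⊓ X β))}
    ... | no ¬elig | _                            = inj₂ (ineligible ¬elig)
    ... | yes _    | yes (β , β≺γ , keptβ , unb)  = inj₂ (meets β≺γ keptβ unb)
    ... | yes elig | no none                      = inj₁ (kept elig ad)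
      where
      ad : ∀ {β} → β ≺ γ → Dropped β ⊎ Bounded (Y γ ⊓ X β)
      ad {β} β≺γ with go (rs β≺γ)
      ... | inj₂ droppedβ = inj₁ droppedβ
      ... | inj₁ keptβ    = inj₂ (dne λ ¬bdd →
        none (β , β≺γ , keptβ , ¬Bounded⇒Unbounded {Y γ ⊓ X β} ¬bdd))

  X-unbounded : ∀ {γ} → Kept γ → Unbounded (X γ)
  X-unbounded {γ} (kept (unb , _) _) = thin-unbounded (g γ) (Y γ) unb

  X-small : ∀ {γ} → Kept γ → Small (X γ)
  X-small {γ} (kept (_ , small) _) = Small-anti {X γ} {Y γ} (X⊆Y γ) small

  X-almostDisjoint : ∀ {β γ} → β ≺ γ → Kept β → Kept γ → Bounded (X γ ⊓ X β)
  X-almostDisjoint {β} {γ} β≺γ keptβ (kept _ ad) with ad β≺γ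
  ... | inj₁ droppedβ = contradiction droppedβ (kept-not-dropped keptβ)
  ... | inj₂ bdd      = Bounded-anti {X γ ⊓ X β} {Y γ ⊓ X β}
    (λ {n} → ⊓-mono {X γ} {Y γ} {X β} {X β} (X⊆Y γ) id {n}) bdd

  -- Every function is some `f δ`, so it governs the gaps of all `X γ` except those with `γ ≺ δ`,
  -- which are countably many.
  X-gaps : ∀ {γ δ} → ¬ (γ ≺ δ) →
    ∃[ N ] (∀ {m n} → N ≤ m → m ∈ X γ → n ∈ X γ → m < n → f δ m ≤ n)
  X-gaps {γ} γ⊀δ with N , f≤g ← g-dominates γ⊀δ =
    N , λ {m} N≤m m∈ n∈ m<n → ≤-trans (f≤g m N≤m) (thin-gaps (g γ) (Y γ) m∈ n∈ m<n)

  -- The family is infinite and maximal almost disjoint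

  𝒜 : Family
  𝒜 = record
    { mem  = λ Z → ∃[ γ ] (Kept γ × Z ≗ X γ)
    ; resp = λ Z≗Z′ (γ , keptγ , Z≗Xγ) → γ , keptγ , λ n → trans (sym (Z≗Z′ n)) (Z≗Xγ n)
    }

  X∈𝒜 : ∀ {γ} → Kept γ → mem 𝒜 (X γ)
  X∈𝒜 {γ} keptγ = γ , keptγ , λ _ → refl

  member-unbounded : ∀ {Z} → mem 𝒜 Z → Unbounded Z
  member-unbounded {Z} (γ , keptγ , Z≗Xγ) =
    Unbounded-mono {X γ} {Z} (≗⇒⊆ (sym ∘ Z≗Xγ)) (X-unbounded keptγ)

  distinct⇒bounded : ∀ {Z Z′} (p : mem 𝒜 Z) (p′ : mem 𝒜 Z′) →
    proj₁ p ≢ proj₁ p′ → Bounded (Z ⊓ Z′)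
  distinct⇒bounded {Z} {Z′} (γ , keptγ , Z≗) (γ′ , keptγ′ , Z′≗) γ≢γ′ with compare γ γ′
  ... | tri≈ _ γ≡γ′ _ = contradiction γ≡γ′ γ≢γ′
  ... | tri> _ _ γ′≺γ = Bounded-anti {Z ⊓ Z′} {X γ ⊓ X γ′}
    (λ {n} → ⊓-mono {Z} {X γ} {Z′} {X γ′} (≗⇒⊆ Z≗) (≗⇒⊆ Z′≗) {n})
    (X-almostDisjoint γ′≺γ keptγ′ keptγ)
  ... | tri< γ≺γ′ _ _ = Bounded-anti {Z ⊓ Z′} {X γ′ ⊓ X γ}
    (λ {n} n∈ → ⊓-greatest {X γ′} {X γ} {Z ⊓ Z′} (λ {n} → ≗⇒⊆ Z′≗ ∘ ⊓-⊆ʳ Z Z′ {n})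
                  (λ {n} → ≗⇒⊆ Z≗ ∘ ⊓-⊆ˡ Z Z′ {n}) {n} n∈)
    (X-almostDisjoint γ≺γ′ keptγ keptγ′)

  -- An unbounded set is not almost disjoint from itself.
  index-unique : ∀ {Z Z′} (p : mem 𝒜 Z) (p′ : mem 𝒜 Z′) → Z ≗ Z′ → proj₁ p ≡ proj₁ p′
  index-unique {Z} {Z′} p p′ Z≗Z′ = dne λ γ≢γ′ →
    Bounded⇒¬Unbounded {Z ⊓ Z′} (distinct⇒bounded p p′ γ≢γ′)
      (Unbounded-mono {Z} {Z ⊓ Z′} (λ {n} → ⊓-greatest {Z} {Z′} {Z} id (≗⇒⊆ Z≗Z′) {n})
        (member-unbounded p))

  𝒜-maximal : ∀ Z → Unbounded Z → ∃[ A ] (mem 𝒜 A × Unbounded (Z ⊓ A))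
  -- The index of a small subset is eligible, so it is dropped only if an earlier kept set already
  -- meets `Z` in an unbounded set.
  𝒜-maximal Z unb with Z′ , Z′⊆Z , unb′ , small′ ← small-subset {Z} unb
    with γ , Yγ≗Z′ ← Y-index Z′ with kept-or-dropped γ
  ... | inj₁ keptγ = X γ , X∈𝒜 keptγ , Unbounded-mono {X γ} {Z ⊓ X γ}
    (λ {n} → ⊓-greatest {Z} {X γ} {X γ} (Z′⊆Z ∘ ≗⇒⊆ Yγ≗Z′ ∘ X⊆Y γ) id {n}) (X-unbounded keptγ)
  ... | inj₂ (ineligible ¬elig) = contradiction
    (Unbounded-mono {Z′} {Y γ} (≗⇒⊆ (sym ∘ Yγ≗Z′)) unb′ , Small-anti {Y γ} {Z′} (≗⇒⊆ Yγ≗Z′) small′) ¬elig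
  ... | inj₂ (meets {β} _ keptβ unbβ) = X β , X∈𝒜 keptβ , Unbounded-mono {Y γ ⊓ X β} {Z ⊓ X β}
    (λ {n} → ⊓-mono {Y γ} {Z} {X β} {X β} (Z′⊆Z ∘ ≗⇒⊆ Yγ≗Z′) id {n}) unbβ

  one-column : ∀ {A B i j} → mem 𝒜 A → A ≗ B →
    Unbounded (column i ⊓ A) → Unbounded (column j ⊓ B) → i ≡ j
  one-column {A} {B} {i} {j} (γ , keptγ , A≗Xγ) A≗B unbᵢ unbⱼ = X-small keptγ i j
    (into i A unbᵢ (≗⇒⊆ A≗Xγ)) (into j B unbⱼ (≗⇒⊆ A≗Xγ ∘ ≗⇒⊆ (sym ∘ A≗B)))
    where
    into : ∀ k Z → Unbounded (column k ⊓ Z) → Z ⊆ X γ → Unbounded (X γ ⊓ column k)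
    into k Z unb Z⊆X = Unbounded-mono {column k ⊓ Z} {X γ ⊓ column k}
      (λ {n} → ⊓-greatest {X γ} {column k} {column k ⊓ Z}
        (λ {n} → Z⊆X ∘ ⊓-⊆ʳ (column k) Z {n}) (λ {n} → ⊓-⊆ˡ (column k) Z {n}) {n}) unb

  -- By maximality each column is met by a member, and by smallness no member can be the one for two
  -- columns.
  𝒜-infinite : Infinite (Subset 𝒫ω-setoid (mem 𝒜))
  𝒜-infinite (_ , inj) = ℕ→Fin-notInjective (λ k → to (hit k , hit∈𝒜 k)) λ {i} {j} eq →
    one-column (hit∈𝒜 i) (injective eq) (hit-unbounded i) (hit-unbounded j)
    where
    open Injection inj using (to; injective)
    hit : ℕ → 𝒫ω
    hit k = proj₁ (𝒜-maximal (column k) (column-unbounded k))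
    hit∈𝒜 : ∀ k → mem 𝒜 (hit k)
    hit∈𝒜 k = proj₁ (proj₂ (𝒜-maximal (column k) (column-unbounded k)))
    hit-unbounded : ∀ k → Unbounded (column k ⊓ hit k)
    hit-unbounded k = proj₂ (proj₂ (𝒜-maximal (column k) (column-unbounded k)))

  𝒜-isMAD : IsMAD 𝒜
  𝒜-isMAD = record
    { infinite       = 𝒜-infinite
    ; members        = λ Z p → Unbounded⇒Infinite {Z} (member-unbounded p)
    ; almostDisjoint = λ Z Z′ p p′ Z≇Z′ → Bounded⇒Finite {Z ⊓ Z′}
        (distinct⇒bounded p p′ (Z≇Z′ ∘ same-index p p′))
    ; maximal        = λ Z inf → let A , A∈𝒜 , unb = 𝒜-maximal Z (Infinite⇒Unbounded {Z} inf) in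
        A , A∈𝒜 , Unbounded⇒Infinite {Z ⊓ A} unb
    }
    where
    same-index : ∀ {Z Z′} (p : mem 𝒜 Z) (p′ : mem 𝒜 Z′) → proj₁ p ≡ proj₁ p′ → Z ≗ Z′
    same-index (γ , _ , Z≗) (.γ , _ , Z′≗) refl n = trans (Z≗ n) (sym (Z′≗ n))

  -- Concentration on the finite sets

  𝒜-concentrated : ConcentratedOnFinite 𝒜
  𝒜-concentrated U U-open fin⊆U = record
    { to        = λ (_ , p , ∉U) → code (proj₁ p , early p ∉U)
    ; cong      = λ {(_ , p , _)} {(_ , p′ , _)} Z≗Z′ → code-cong (index-unique p p′ Z≗Z′)
    ; injective = λ { {_ , (γ , _ , Z≗) , _} {_ , (γ′ , _ , Z′≗) , _} eq n →
        trans (Z≗ n) (trans (cong (λ β → X β n) (code-injective eq)) (sym (Z′≗ n))) }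
    }
    where
    h : ℕ → ℕ
    -- The interval to be missed starts just after an element `n`, hence `suc n`.
    h n = proj₁ (interval-length U-open fin⊆U (suc n))
    δ : W
    δ = proj₁ (f-index h)
    open Injection (initialCountable δ) using () renaming (to to code; cong to code-cong; injective to code-injective)
    early : ∀ {Z} (p : mem 𝒜 Z) → ¬ U Z → proj₁ p ≺ δ
    -- Otherwise some element `m` of `Z` is followed by no other below `h m`, which puts `Z` into
    -- `U`.
    early {Z} (γ , keptγ , Z≗Xγ) Z∉U = dne λ γ⊀δ →
      let N , gaps     = X-gaps γ⊀δ
          m , N≤m , m∈ = X-unbounded keptγ N
      in Z∉U (proj₂ (interval-length U-open fin⊆U (suc m)) Z λ i m<i i<h →
           trans (Z≗Xγ i) (¬-not λ i∈ →
             <⇒≱ i<h (subst (_≤ i) (proj₂ (f-index h) m) (gaps N≤m m∈ i∈ m<i))))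

  -- The λ-property

  𝒜-isLambdaSet : IsLambdaSet 𝒜
  𝒜-isLambdaSet 𝒞 𝒞⊑𝒜 count =
    (λ k Z → ShortGap k Z × Avoids k Z) , (λ k → ×-open (shortGap-open k) (avoids-open k)) ,
    λ Z Z∈𝒜 → mk⇔
      (λ Z∈𝒞 k → short Z∈𝒞 k ,
        λ _ _ Xβ∉𝒞 → dne λ same → Xβ∉𝒞 (resp 𝒞 (λ n → dne λ ≢n → same (n , ≢n)) Z∈𝒞))
      (λ ∈U → dne (not-outside Z∈𝒜 ∈U))
    where
    bound : ∃[ h ] (∀ ((C , _) : Σ 𝒫ω (mem 𝒞)) → ∃[ N ] (∀ m → N ≤ m → ∃[ n ] (m < n × n < h m × n ∈ C)))
    bound = diagonal-bound (Subset 𝒫ω-setoid (mem 𝒞)) count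
      (λ (C , _) m b → ∃[ n ] (m < n × n < b × n ∈ C))
      (λ C≗C′ (n , m<n , n<b , n∈C) → n , m<n , n<b , ≗⇒⊆ C≗C′ n∈C)
      (λ b≤b′ (n , m<n , n<b , n∈C) → n , m<n , <-≤-trans n<b b≤b′ , n∈C)
      (λ (C , C∈𝒞) m → let n , m<n , n∈C = member-unbounded (𝒞⊑𝒜 C C∈𝒞) (suc m) in
        suc n , n , m<n , ≤-refl , n∈C)
    h : ℕ → ℕ
    h = proj₁ bound
    δ : W
    δ = proj₁ (f-index h)
    open Injection (initialCountable δ) using () renaming (to to code; injective to code-injective)

    ShortGap : ℕ → Pred 𝒫ω 0ℓ
    ShortGap k Z = ∃[ m ] (k ≤ m × m ∈ Z × ∃[ n ] (m < n × n < h m × n ∈ Z))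

    -- The complement of the point `X β` if `k` is the code of some `β` with `X β` outside `𝒞`, and
    -- the whole space otherwise.
    Avoids : ℕ → Pred 𝒫ω 0ℓ
    Avoids k Z = ∀ (β≺ : Σ W (_≺ δ)) → code β≺ ≡ k → ¬ mem 𝒞 (X (proj₁ β≺)) → ∃[ n ] Z n ≢ X (proj₁ β≺) n

    shortGap-open : ∀ k → Open (ShortGap k)
    shortGap-open k Z (m , k≤m , m∈Z , n , m<n , n<h , n∈Z) = m ∷ n ∷ [] ,
      λ { Z′ (eqₘ ∷ eqₙ ∷ []) →
          m , k≤m , trans (sym eqₘ) m∈Z , n , m<n , n<h , trans (sym eqₙ) n∈Z }

    avoids-open : ∀ k → Open (Avoids k)
    avoids-open k Z avoids with em {∃[ β≺ ] (code β≺ ≡ k × ¬ mem 𝒞 (X (proj₁ β≺)))}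
    ... | no none = [] , λ _ _ β≺ eq ∉𝒞 → contradiction (β≺ , eq , ∉𝒞) none
    -- Codes are injective, so only one point is to be avoided and one coordinate suffices.
    ... | yes (α≺ , eqα , ∉𝒞) with n , Zn≢ ← avoids α≺ eqα ∉𝒞 = n ∷ [] ,
      λ { Z′ (eqₙ ∷ []) β≺ eqβ _ → n , λ Z′n≡ → Zn≢ (trans eqₙ (trans Z′n≡
            (cong (λ β → X β n) (code-injective (trans eqβ (sym eqα)))))) }

    ×-open : ∀ {U V : Pred 𝒫ω 0ℓ} → Open U → Open V → Open (λ Z → U Z × V Z)
    ×-open U-open V-open Z (Z∈U , Z∈V) =
      let F , F⊆U = U-open Z Z∈U
          G , G⊆V = V-open Z Z∈V
      in F ++ G , λ Z′ eqs → F⊆U Z′ (++⁻ˡ F eqs) , G⊆V Z′ (++⁻ʳ F eqs)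

    short : ∀ {Z} → mem 𝒞 Z → ∀ k → ShortGap k Z
    short {Z} Z∈𝒞 k =
      let N , next-in   = proj₂ bound (Z , Z∈𝒞)
          m , kN≤m , m∈ = member-unbounded (𝒞⊑𝒜 Z Z∈𝒞) (k ⊔ N)
      in m , ≤-trans (m≤m⊔n k N) kN≤m , m∈ , next-in m (≤-trans (m≤n⊔m k N) kN≤m)

    not-outside : ∀ {Z} → mem 𝒜 Z → (∀ k → ShortGap k Z × Avoids k Z) → ¬ ¬ mem 𝒞 Z
    -- For `γ ≺ δ` the set `Z` is itself one of the avoided points; otherwise its late gaps are too
    -- long for `ShortGap`.
    not-outside {Z} (γ , _ , Z≗Xγ) ∈U Z∉𝒞 with em {γ ≺ δ}
    ... | yes γ≺δ =
      let n , Zn≢ = proj₂ (∈U (code (γ , γ≺δ))) (γ , γ≺δ) refl (Z∉𝒞 ∘ resp 𝒞 (sym ∘ Z≗Xγ))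
      in Zn≢ (Z≗Xγ n)
    ... | no γ⊀δ =
      let N , gaps = X-gaps γ⊀δ
          m , N≤m , m∈Z , n , m<n , n<h , n∈Z = proj₁ (∈U N)
      in <⇒≱ n<h (subst (_≤ n) (proj₂ (f-index h) m)
           (gaps N≤m (≗⇒⊆ Z≗Xγ m∈Z) (≗⇒⊆ Z≗Xγ n∈Z) m<n))

theorem4 : ExcludedMiddle 0ℓ → CH →
    Σ[ 𝒜 ∈ Family ] (IsMAD 𝒜 × IsLambdaSet 𝒜 × ConcentratedOnFinite 𝒜)
theorem4 em (_ , _ , isω₁ , enum) = 𝒜 , 𝒜-isMAD , 𝒜-isLambdaSet , 𝒜-concentrated
  where open Construction em isω₁ enum
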